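{- Let $n \geq 0$ and let $M, K \models \mathbf{PA}^-$ be such that $K$ is a cofinal extension of $M$ and $M \prec_{\Delta_0} K$. 1. If $M \models \mathbf{Coll}(\Sigma_{n+1})$, then $M \prec_{\Sigma_{n+2}} K$. 2. If $M \models \mathbf{Coll}_{\mathrm{s}}(\Sigma_{n+1})$, then $K \models \mathbf{Coll}_{\mathrm{s}}(\Sigma_{n+1})$.
   Context: $\mathcal{L}_A=\{0,1,+,\times,<\}$ is the language of first-order arithmetic, and $\mathbf{PA}^-$ is the $\mathcal{L}_A$-theory of the non-negative parts of commutative discretely ordered rings. $\Delta_0=\Sigma_0=\Pi_0$ is the class of $\mathcal{L}_A$-formulas all of whose quantifiers are bounded; $\Sigma_{n+1}$ (resp. $\Pi_{n+1}$) formulas are those of the form $\exists \vec{y}\,\varphi$ with $\varphi\in\Pi_n$ (resp. $\forall \vec{y}\,\varphi$ with $\varphi\in\Sigma_n$), where $\vec{y}$ is a finite, possibly empty, tuple. Vector notation denotes finite (possibly empty) tuples of variables or elements; for tuples of the same length, $\vec{x}<\vec{u}$ means $x_i<u_i$ for every $i$. $M\prec_\Gamma K$ means $M$ is a substructure of $K$ and for every $\vec{a}\in M$ and every $\varphi(\vec{x})\in\Gamma$, $M\models\varphi(\vec{a})$ iff $K\models\varphi(\vec{a})$. $K$ is a cofinal extension of $M$ iff $M$ is a substructure of $K$ and for every $a\in K$ there is $b\in M$ with $K\models a<b$. $\mathbf{Coll}(\Gamma)$ is the scheme $\forall \vec{z}\,\forall \vec{u}\,(\forall \vec{x}<\vec{u}\,\exists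 \vec{y}\,\varphi(\vec{x},\vec{y},\vec{z})\to\exists \vec{v}\,\forall \vec{x}<\vec{u}\,\exists \vec{y}<\vec{v}\,\varphi(\vec{x},\vec{y},\vec{z}))$ for $\varphi\in\Gamma$. $\mathbf{Coll}_{\mathrm{s}}(\Gamma)$ is the scheme $\forall \vec{z}\,\forall \vec{u}\,\exists \vec{v}\,\forall \vec{x}<\vec{u}\,(\exists \vec{y}\,\varphi(\vec{x},\vec{y},\vec{z})\to\exists \vec{y}<\vec{v}\,\varphi(\vec{x},\vec{y},\vec{z}))$ for $\varphi\in\Gamma$. -}

module Defs where

open import Level using (_⊔_) renaming (suc to lsuc)
open import Algebra.Structures using (IsCommutativeRing)
open import Data.Empty.Polymorphic using (⊥)
open import Data.Fin using (Fin; zero; suc)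
open import Data.Nat as ℕ using (ℕ; zero; suc)
open import Data.Product using (Σ; Σ-syntax; ∃-syntax; _×_; _,_)
open import Data.Sum using (_⊎_)
open import Data.Vec using (Vec; []; _∷_; _++_; lookup; map)
open import Data.Vec.Relation.Binary.Pointwise.Inductive using (Pointwise)
open import Function.Bundles using (_⇔_)
open import Function.Definitions using (Injective)
open import Relation.Binary using (Rel; IsStrictTotalOrder; tri<; tri≈; tri>)
open import Relation.Binary.PropositionalEquality
  using (_≡_; refl; subst)
open import Relation.Nullary using (¬_)

------------------------------------------------------------------------
-- Syntax of first-order arithmetic

-- Variables are de Bruijn indices; `zero` is the innermost one.

infixl 7 _`*_
infixl 6 _`+_
infix  4 _`≡_ _`<_
infixr 3 _`∧_
infixr 2 _`∨_
infixr 1 _`⇒_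

data Term (k : ℕ) : Set where
  var       : Fin k → Term k
  `0 `1     : Term k
  _`+_ _`*_ : Term k → Term k → Term k

data Formula (k : ℕ) : Set where
  _`≡_ _`<_      : Term k → Term k → Formula k
  `⊥             : Formula k
  _`∧_ _`∨_ _`⇒_ : Formula k → Formula k → Formula k
  `∀_ `∃_        : Formula (suc k) → Formula k

`¬_ : ∀ {k} → Formula k → Formula k
`¬ φ = φ `⇒ `⊥

Sentence : Set
Sentence = Formula 0

wk : ∀ {k} → Term k → Term (suc k)
wk (var i)  = var (suc i)
wk `0       = `0
wk `1       = `1
wk (s `+ t) = wk s `+ wk t
wk (s `* t) = wk s `* wk t

`∀[_]_ `∃[_]_ : ∀ {k} m → Formula (m ℕ.+ k) → Formula k
`∀[ zero  ] φ = φ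
`∀[ suc m ] φ = `∀[ m ] (`∀ φ)
`∃[ zero  ] φ = φ
`∃[ suc m ] φ = `∃[ m ] (`∃ φ)

------------------------------------------------------------------------
-- The arithmetical hierarchy

FormulaClass : Set₁
FormulaClass = ∀ {k} → Formula k → Set

-- A bounded quantifier ∀x<t or ∃x<t is an abbreviation for
-- ∀x (x<t → …) or ∃x (x<t ∧ …), where x does not occur in the term t.

data Δ₀ {k} : Formula k → Set where
  eq   : ∀ s t → Δ₀ (s `≡ t)
  less : ∀ s t → Δ₀ (s `< t)
  bot  : Δ₀ `⊥
  and  : ∀ {φ ψ} → Δ₀ φ → Δ₀ ψ → Δ₀ (φ `∧ ψ)
  or   : ∀ {φ ψ} → Δ₀ φ → Δ₀ ψ → Δ₀ (φ `∨ ψ)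
  imp  : ∀ {φ ψ} → Δ₀ φ → Δ₀ ψ → Δ₀ (φ `⇒ ψ)
  all< : ∀ t {φ} → Δ₀ φ → Δ₀ (`∀ (var zero `< wk t `⇒ φ))
  ex<  : ∀ t {φ} → Δ₀ φ → Δ₀ (`∃ (var zero `< wk t `∧ φ))

-- Membership is syntactic (not up to logical equivalence), and a block
-- of quantifiers may be empty.

mutual
  data Σₙ : ℕ → FormulaClass where
    base  : ∀ {k} {φ : Formula k} → Δ₀ φ → Σₙ 0 φ
    block : ∀ {n k} m {φ : Formula (m ℕ.+ k)} →
            Πₙ n φ → Σₙ (suc n) (`∃[ m ] φ)

  data Πₙ : ℕ → FormulaClass where
    base  : ∀ {k} {φ : Formula k} → Δ₀ φ → Πₙ 0 φ
    block : ∀ {n k} m {φ : Formula (m ℕ.+ k)} →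
            Σₙ n φ → Πₙ (suc n) (`∀[ m ] φ)

------------------------------------------------------------------------
-- Structures and satisfaction

record Structure ℓ : Set (lsuc ℓ) where
  infixl 7 _*_
  infixl 6 _+_
  infix  4 _<_
  field
    Carrier : Set ℓ
    0# 1#   : Carrier
    _+_ _*_ : Carrier → Carrier → Carrier
    _<_     : Rel Carrier ℓ

  ⟦_⟧ : ∀ {k} → Term k → Vec Carrier k → Carrier
  ⟦ var i  ⟧ ρ = lookup ρ i
  ⟦ `0     ⟧ ρ = 0#
  ⟦ `1     ⟧ ρ = 1#
  ⟦ s `+ t ⟧ ρ = ⟦ s ⟧ ρ + ⟦ t ⟧ ρ
  ⟦ s `* t ⟧ ρ = ⟦ s ⟧ ρ * ⟦ t ⟧ ρ

  infix 4 _<ᵛ_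
  _<ᵛ_ : ∀ {k} → Vec Carrier k → Vec Carrier k → Set ℓ
  _<ᵛ_ = Pointwise _<_

open Structure using () renaming (Carrier to ∣_∣)

infix 4 _⊨_[_] _⊨_ _⊨ᵀ_

_⊨_[_] : ∀ {ℓ} (M : Structure ℓ) {k} → Formula k → Vec ∣ M ∣ k → Set ℓ
M ⊨ s `≡ t [ ρ ] = Structure.⟦_⟧ M s ρ ≡ Structure.⟦_⟧ M t ρ
M ⊨ s `< t [ ρ ] = Structure._<_ M (Structure.⟦_⟧ M s ρ) (Structure.⟦_⟧ M t ρ)
M ⊨ `⊥     [ ρ ] = ⊥
M ⊨ φ `∧ ψ [ ρ ] = M ⊨ φ [ ρ ] × M ⊨ ψ [ ρ ]
M ⊨ φ `∨ ψ [ ρ ] = M ⊨ φ [ ρ ] ⊎ M ⊨ ψ [ ρ ]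
M ⊨ φ `⇒ ψ [ ρ ] = M ⊨ φ [ ρ ] → M ⊨ ψ [ ρ ]
M ⊨ `∀ φ   [ ρ ] = ∀ a → M ⊨ φ [ a ∷ ρ ]
M ⊨ `∃ φ   [ ρ ] = ∃[ a ] M ⊨ φ [ a ∷ ρ ]

_⊨_ : ∀ {ℓ} → Structure ℓ → Sentence → Set ℓ
M ⊨ σ = M ⊨ σ [ [] ]

Theory : ∀ ℓ → Set (lsuc ℓ)
Theory ℓ = Sentence → Set ℓ

_⊨ᵀ_ : ∀ {ℓ ℓ′} → Structure ℓ → Theory ℓ′ → Set (ℓ ⊔ ℓ′)
M ⊨ᵀ T = ∀ σ → T σ → M ⊨ σ

------------------------------------------------------------------------
-- PA⁻

record DiscretelyOrderedRing ℓ : Set (lsuc ℓ) where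
  infix  8 -_
  infixl 7 _*_
  infixl 6 _+_
  infix  4 _<_
  field
    Carrier            : Set ℓ
    _+_ _*_            : Carrier → Carrier → Carrier
    -_                 : Carrier → Carrier
    0# 1#              : Carrier
    _<_                : Rel Carrier ℓ
    isCommutativeRing  : IsCommutativeRing _≡_ _+_ _*_ -_ 0# 1#
    isStrictTotalOrder : IsStrictTotalOrder _≡_ _<_
    +-monoˡ-<          : ∀ {x y} z → x < y → x + z < y + z
    *-pos              : ∀ {x y} → 0# < x → 0# < y → 0# < x * y
    0<1                : 0# < 1#
    discrete           : ∀ x → ¬ (0# < x × x < 1#)

  open IsCommutativeRing isCommutativeRing public
    using (+-identityˡ; zeroˡ; zeroʳ)
  open IsStrictTotalOrder isStrictTotalOrder public
    using (compare; irrefl; asym) renaming (trans to <-trans)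

  NonNegative : Carrier → Set ℓ
  NonNegative x = ¬ (x < 0#)

  +-nonNeg : ∀ {x y} → NonNegative x → NonNegative y → NonNegative (x + y)
  +-nonNeg {x} {y} x≥0 y≥0 x+y<0 with compare x 0#
  ... | tri< x<0 _ _  = x≥0 x<0
  ... | tri≈ _ refl _ = y≥0 (subst (_< 0#) (+-identityˡ y) x+y<0)
  ... | tri> _ _ 0<x  =
    y≥0 (<-trans (subst (_< x + y) (+-identityˡ y) (+-monoˡ-< y 0<x)) x+y<0)

  *-nonNeg : ∀ {x y} → NonNegative x → NonNegative y → NonNegative (x * y)
  *-nonNeg {x} {y} x≥0 y≥0 xy<0 with compare x 0# | compare y 0#
  ... | tri< x<0 _ _  | _             = x≥0 x<0
  ... | _             | tri< y<0 _ _  = y≥0 y<0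
  ... | tri≈ _ refl _ | _             = irrefl (zeroˡ y) xy<0
  ... | _             | tri≈ _ refl _ = irrefl (zeroʳ x) xy<0
  ... | tri> _ _ 0<x  | tri> _ _ 0<y  = asym (*-pos 0<x 0<y) xy<0

-- Proofs of a negation are definitionally equal, so equality of elements
-- of this structure is equality in the ring.

nonNegativePart : ∀ {ℓ} → DiscretelyOrderedRing ℓ → Structure ℓ
nonNegativePart R = record
  { Carrier = Σ Carrier NonNegative
  ; 0#      = 0# , irrefl refl
  ; 1#      = 1# , asym 0<1
  ; _+_     = λ (x , x≥0) (y , y≥0) → x + y , +-nonNeg x≥0 y≥0
  ; _*_     = λ (x , x≥0) (y , y≥0) → x * y , *-nonNeg x≥0 y≥0
  ; _<_     = λ (x , _) (y , _) → x < y
  }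
  where open DiscretelyOrderedRing R

PA⁻ : ∀ ℓ → Theory (lsuc ℓ)
PA⁻ ℓ σ = (R : DiscretelyOrderedRing ℓ) → nonNegativePart R ⊨ σ

------------------------------------------------------------------------
-- Extensions

-- The inclusion of a substructure M of K is represented by an injective
-- map that preserves the operations and preserves and reflects the order.

record Substructure {ℓ} (M K : Structure ℓ) : Set ℓ where
  private
    module M = Structure M
    module K = Structure K
  field
    ι         : M.Carrier → K.Carrier
    injective : Injective _≡_ _≡_ ι
    0-homo    : ι M.0# ≡ K.0#
    1-homo    : ι M.1# ≡ K.1#
    +-homo    : ∀ a b → ι (a M.+ b) ≡ ι a K.+ ι b
    *-homo    : ∀ a b → ι (a M.* b) ≡ ι a K.* ι b
    <-iff     : ∀ a b → (a M.< b) ⇔ (ι a K.< ι b)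

module _ {ℓ} {M K : Structure ℓ} (M⊆K : Substructure M K) where
  open Substructure M⊆K

  Cofinal : Set ℓ
  Cofinal = ∀ a → ∃[ b ] Structure._<_ K a (ι b)

  Elementary : FormulaClass → Set ℓ
  Elementary Γ = ∀ {k} (φ : Formula k) → Γ φ → (ρ : Vec ∣ M ∣ k) →
                 (M ⊨ φ [ ρ ]) ⇔ (K ⊨ φ [ map ι ρ ])

------------------------------------------------------------------------
-- Collection

-- The free variables of φ(x⃗, y⃗, z⃗) are listed innermost first, so an
-- assignment to them is ys ++ xs ++ zs. `Coll M Γ` and `Collₛ M Γ` spell
-- out the satisfaction in M of every instance of the two schemes.

module _ {ℓ} (M : Structure ℓ) (Γ : FormulaClass) where
  open Structure M using (_<ᵛ_)

  private
    Tuple : ℕ → Set ℓ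
    Tuple = Vec ∣ M ∣

  Coll : Set ℓ
  Coll = ∀ p q r (φ : Formula (q ℕ.+ (p ℕ.+ r))) → Γ φ →
    (zs : Tuple r) (us : Tuple p) →
    (∀ xs → xs <ᵛ us → Σ[ ys ∈ Tuple q ] M ⊨ φ [ ys ++ xs ++ zs ]) →
    ∃[ vs ] ∀ xs → xs <ᵛ us →
      Σ[ ys ∈ Tuple q ] ys <ᵛ vs × M ⊨ φ [ ys ++ xs ++ zs ]

  Collₛ : Set ℓ
  Collₛ = ∀ p q r (φ : Formula (q ℕ.+ (p ℕ.+ r))) → Γ φ →
    (zs : Tuple r) (us : Tuple p) →
    ∃[ vs ] ∀ xs → xs <ᵛ us →
      (Σ[ ys ∈ Tuple q ] M ⊨ φ [ ys ++ xs ++ zs ]) →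
      Σ[ ys ∈ Tuple q ] ys <ᵛ vs × M ⊨ φ [ ys ++ xs ++ zs ]

{-# OPTIONS --safe #-}

-- Call a formula tame if, below every bound from M, it agrees in both M and
-- K with one Δ₀ formula with parameters from M. Tame formulas are preserved
-- between M and K. If φ is tame and v bounds in M the witnesses y of
-- φ(x,y) for all x < u, then v does so in K too: a counterexample lies below
-- some bound from M by cofinality, so that its existence is a Δ₀ statement
-- about elements of M. Hence ∃y φ is tame as well, and strong collection for
-- Σₙ₊₁ in M makes all Σₙ₊₁ formulas tame and passes to K.
-- Collection for Σₙ₊₁ gives strong collection for the Π classes below n, so
-- that Πₙ is tame. Suppose now that K ⊨ ∃y φ with φ ∈ Πₙ₊₁ and M ⊭ ∃y φ.
-- Bound y by some b in M; collection bounds by some c in M the witnesses of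
-- ¬φ(y) for y < b. By tameness, "each y < b has such a witness below c" is
-- Δ₀, so it holds in K, a contradiction.
module Submission where

open import Defs
open import Axiom.ExcludedMiddle using (ExcludedMiddle)
open import Data.Bool using (Bool; true; false)
open import Data.Empty.Polymorphic using (⊥; ⊥-elim)
open import Data.Fin using (Fin; zero; suc; _↑ˡ_; _↑ʳ_; splitAt; lift)
open import Data.Nat using (ℕ; zero; suc; _+_; _≤_; _<_; z≤n; s≤s; s≤s⁻¹)
open import Data.Nat.Properties using (m≤n⇒m≤1+n; ≤-refl)
open import Data.Product using (Σ; Σ-syntax; ∃-syntax; _×_; _,_; proj₁; proj₂)
open import Data.Sum using (_⊎_; inj₁; inj₂; [_,_]′)
open import Data.Vec using (Vec; []; _∷_; _++_; lookup; map; replicate)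
import Data.Vec as Vec
open import Data.Vec.Properties
  using (lookup-++ˡ; lookup-++ʳ; lookup-splitAt; lookup-map; map-++)
open import Data.Vec.Relation.Binary.Pointwise.Inductive
  using ([]; _∷_; ++⁺)
  renaming (trans to pointwise-trans)
open import Function using (_∘_; id; case_of_)
open import Function.Bundles using (_⇔_; mk⇔; module Equivalence)
open import Function.Construct.Identity using (⇔-id)
open import Function.Construct.Composition using (_⇔-∘_)
open import Function.Construct.Symmetry using (⇔-sym)
open import Level using (Level)
open import Relation.Binary using (Transitive)
open import Relation.Binary.PropositionalEquality
  using (_≡_; refl; sym; trans; cong; cong₂; subst)
open import Relation.Nullary using (yes; no; contradiction)

open Equivalence using (to; from)

open Structure using () renaming (Carrier to ∣_∣)

private variable
  ℓ         : Level
  k l m n q : ℕ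

-- Renaming

-- Every renaming below is assembled in parallel with a proof of its `Picks` specification, which
-- `ren-⊨` turns into an equivalence of satisfaction.
record Picks {A : Set ℓ} (ρ : Vec A l) (f : Fin k → Fin l) (xs : Vec A k) : Set ℓ where
  constructor picks
  field at : ∀ i → lookup ρ (f i) ≡ lookup xs i
open Picks

join : (Fin m → Fin l) → (Fin k → Fin l) → Fin (m + k) → Fin l
join {m = m} f g = [ f , g ]′ ∘ splitAt m

lifts : ∀ m → (Fin k → Fin l) → Fin (m + k) → Fin (m + l)
lifts zero    f = f
lifts (suc m) f = lift 1 (lifts m f)

module _ {A : Set ℓ} where

  picks-∘ : {ρ : Vec A m} {σ : Vec A l} {xs : Vec A k}
            {f : Fin l → Fin m} {g : Fin k → Fin l} →
            Picks ρ f σ → Picks σ g xs → Picks ρ (f ∘ g) xs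
  picks-∘ {g = g} (picks p) (picks q) = picks λ i → trans (p (g i)) (q i)

  picks-ˡ : (xs : Vec A k) (ys : Vec A l) → Picks (xs ++ ys) (_↑ˡ l) xs
  picks-ˡ xs ys = picks (lookup-++ˡ xs ys)

  picks-ʳ : (xs : Vec A k) (ys : Vec A l) → Picks (xs ++ ys) (k ↑ʳ_) ys
  picks-ʳ xs ys = picks (lookup-++ʳ xs ys)

  picks-join : {ρ : Vec A l} {xs : Vec A m} {ys : Vec A k}
               {f : Fin m → Fin l} {g : Fin k → Fin l} →
               Picks ρ f xs → Picks ρ g ys → Picks ρ (join f g) (xs ++ ys)
  picks-join {m = m} {ρ = ρ} {xs} {ys} {f} {g} (picks p) (picks q) = picks λ i →
    trans (go (splitAt m i)) (sym (lookup-splitAt m xs ys i))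
    where
    go : ∀ s → lookup ρ ([ f , g ]′ s) ≡ [ lookup xs , lookup ys ]′ s
    go (inj₁ i) = p i
    go (inj₂ i) = q i

  picks-lift : ∀ a {ρ : Vec A l} {xs : Vec A k} {f : Fin k → Fin l} →
               Picks ρ f xs → Picks (a ∷ ρ) (lift 1 f) (a ∷ xs)
  picks-lift a p = picks λ { zero → refl ; (suc i) → at p i }

  picks-lifts : (ys : Vec A m) {ρ : Vec A l} {xs : Vec A k} {f : Fin k → Fin l} →
                Picks ρ f xs → Picks (ys ++ ρ) (lifts m f) (ys ++ xs)
  picks-lifts []       p = p
  picks-lifts (y ∷ ys) p = picks-lift y (picks-lifts ys p)

renᵗ : (Fin k → Fin l) → Term k → Term l
renᵗ f (var i)  = var (f i)
renᵗ f `0       = `0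
renᵗ f `1       = `1
renᵗ f (s `+ t) = renᵗ f s `+ renᵗ f t
renᵗ f (s `* t) = renᵗ f s `* renᵗ f t

ren : (Fin k → Fin l) → Formula k → Formula l
ren f (s `≡ t) = renᵗ f s `≡ renᵗ f t
ren f (s `< t) = renᵗ f s `< renᵗ f t
ren f `⊥       = `⊥
ren f (φ `∧ ψ) = ren f φ `∧ ren f ψ
ren f (φ `∨ ψ) = ren f φ `∨ ren f ψ
ren f (φ `⇒ ψ) = ren f φ `⇒ ren f ψ
ren f (`∀ φ)   = `∀ ren (lift 1 f) φ
ren f (`∃ φ)   = `∃ ren (lift 1 f) φ

-- `Δ₀` recognises a bounded quantifier by a bound of the form `wk t`, so a renamed bound has to be
-- exhibited as a weakening again.
renᵗ-wk : (f : Fin k → Fin l) (t : Term k) → renᵗ (lift 1 f) (wk t) ≡ wk (renᵗ f t)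
renᵗ-wk f (var i)  = refl
renᵗ-wk f `0       = refl
renᵗ-wk f `1       = refl
renᵗ-wk f (s `+ t) = cong₂ _`+_ (renᵗ-wk f s) (renᵗ-wk f t)
renᵗ-wk f (s `* t) = cong₂ _`*_ (renᵗ-wk f s) (renᵗ-wk f t)

ren-Δ₀ : (f : Fin k → Fin l) {φ : Formula k} → Δ₀ φ → Δ₀ (ren f φ)
ren-Δ₀ f (eq s t)   = eq _ _
ren-Δ₀ f (less s t) = less _ _
ren-Δ₀ f bot        = bot
ren-Δ₀ f (and d e)  = and (ren-Δ₀ f d) (ren-Δ₀ f e)
ren-Δ₀ f (or d e)   = or (ren-Δ₀ f d) (ren-Δ₀ f e)
ren-Δ₀ f (imp d e)  = imp (ren-Δ₀ f d) (ren-Δ₀ f e)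
ren-Δ₀ f (all< t d) rewrite renᵗ-wk f t = all< _ (ren-Δ₀ (lift 1 f) d)
ren-Δ₀ f (ex< t d)  rewrite renᵗ-wk f t = ex< _ (ren-Δ₀ (lift 1 f) d)

ren-∃[] : ∀ m (f : Fin k → Fin l) φ → ren f (`∃[ m ] φ) ≡ `∃[ m ] ren (lifts m f) φ
ren-∃[] zero    f φ = refl
ren-∃[] (suc m) f φ = ren-∃[] m f (`∃ φ)

ren-∀[] : ∀ m (f : Fin k → Fin l) φ → ren f (`∀[ m ] φ) ≡ `∀[ m ] ren (lifts m f) φ
ren-∀[] zero    f φ = refl
ren-∀[] (suc m) f φ = ren-∀[] m f (`∀ φ)

mutual
  ren-Σₙ : (f : Fin k → Fin l) {φ : Formula k} → Σₙ n φ → Σₙ n (ren f φ)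
  ren-Σₙ f (base d) = base (ren-Δ₀ f d)
  ren-Σₙ f (block m {φ} π) rewrite ren-∃[] m f φ = block m (ren-Πₙ (lifts m f) π)

  ren-Πₙ : (f : Fin k → Fin l) {φ : Formula k} → Πₙ n φ → Πₙ n (ren f φ)
  ren-Πₙ f (base d) = base (ren-Δ₀ f d)
  ren-Πₙ f (block m {φ} σ) rewrite ren-∀[] m f φ = block m (ren-Σₙ (lifts m f) σ)

mutual
  -- Empty blocks inserted above the Δ₀ matrix raise the level without changing the formula.
  Σₙ-mono : m ≤ n → {φ : Formula k} → Σₙ m φ → Σₙ n φ
  Σₙ-mono {n = zero}  z≤n     (base d)    = base d
  Σₙ-mono {n = suc n} z≤n     (base d)    = block 0 (Πₙ-mono z≤n (base d))
  Σₙ-mono             (s≤s p) (block m π) = block m (Πₙ-mono p π)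

  Πₙ-mono : m ≤ n → {φ : Formula k} → Πₙ m φ → Πₙ n φ
  Πₙ-mono {n = zero}  z≤n     (base d)    = base d
  Πₙ-mono {n = suc n} z≤n     (base d)    = block 0 (Σₙ-mono z≤n (base d))
  Πₙ-mono             (s≤s p) (block m σ) = block m (Σₙ-mono p σ)

-- `b` names the outer variable that bounds each quantified one. Its index is shifted past the `m`
-- variables not yet quantified, and the bound is written as a weakening to match `ex<`.
bexists : ∀ m → (Fin m → Fin k) → Formula (m + k) → Formula k
bexists zero    b φ = φ
bexists (suc m) b φ =
  bexists m (b ∘ suc) (`∃ (var zero `< wk (var (m ↑ʳ b zero)) `∧ φ))

bexists-Δ₀ : ∀ m (b : Fin m → Fin k) {φ} → Δ₀ φ → Δ₀ (bexists m b φ)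
bexists-Δ₀ zero    b d = d
bexists-Δ₀ (suc m) b d = bexists-Δ₀ m (b ∘ suc) (ex< _ d)

-- Satisfaction of renamed formulas and of quantifier blocks

module _ (N : Structure ℓ) where
  open Structure N using (⟦_⟧; _<ᵛ_)

  ren-⟦⟧ : {f : Fin k → Fin l} (t : Term k) {ρ : Vec ∣ N ∣ l} {σ : Vec ∣ N ∣ k} →
           Picks ρ f σ → ⟦ renᵗ f t ⟧ ρ ≡ ⟦ t ⟧ σ
  ren-⟦⟧ (var i)  p = at p i
  ren-⟦⟧ `0       p = refl
  ren-⟦⟧ `1       p = refl
  ren-⟦⟧ (s `+ t) p = cong₂ (Structure._+_ N) (ren-⟦⟧ s p) (ren-⟦⟧ t p)
  ren-⟦⟧ (s `* t) p = cong₂ (Structure._*_ N) (ren-⟦⟧ s p) (ren-⟦⟧ t p)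

  ren-⊨ : {f : Fin k → Fin l} (φ : Formula k) {ρ : Vec ∣ N ∣ l} {σ : Vec ∣ N ∣ k} →
          Picks ρ f σ → (N ⊨ ren f φ [ ρ ]) ⇔ (N ⊨ φ [ σ ])
  ren-⊨ (s `≡ t) p rewrite ren-⟦⟧ s p | ren-⟦⟧ t p = ⇔-id _
  ren-⊨ (s `< t) p rewrite ren-⟦⟧ s p | ren-⟦⟧ t p = ⇔-id _
  ren-⊨ `⊥       p = ⇔-id _
  ren-⊨ (φ `∧ ψ) p = mk⇔
    (λ (x , y) → to (ren-⊨ φ p) x , to (ren-⊨ ψ p) y)
    (λ (x , y) → from (ren-⊨ φ p) x , from (ren-⊨ ψ p) y)
  ren-⊨ (φ `∨ ψ) p = mk⇔
    (λ { (inj₁ x) → inj₁ (to (ren-⊨ φ p) x) ; (inj₂ y) → inj₂ (to (ren-⊨ ψ p) y) })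
    (λ { (inj₁ x) → inj₁ (from (ren-⊨ φ p) x) ; (inj₂ y) → inj₂ (from (ren-⊨ ψ p) y) })
  ren-⊨ (φ `⇒ ψ) p = mk⇔
    (λ h → to (ren-⊨ ψ p) ∘ h ∘ from (ren-⊨ φ p))
    (λ h → from (ren-⊨ ψ p) ∘ h ∘ to (ren-⊨ φ p))
  ren-⊨ (`∀ φ)   p = mk⇔
    (λ h a → to (ren-⊨ φ (picks-lift a p)) (h a))
    (λ h a → from (ren-⊨ φ (picks-lift a p)) (h a))
  ren-⊨ (`∃ φ)   p = mk⇔
    (λ (a , x) → a , to (ren-⊨ φ (picks-lift a p)) x)
    (λ (a , x) → a , from (ren-⊨ φ (picks-lift a p)) x)

  ∃[]-⊨ : ∀ m (φ : Formula (m + k)) {ρ} →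
          (N ⊨ `∃[ m ] φ [ ρ ]) ⇔ (Σ[ ys ∈ Vec ∣ N ∣ m ] N ⊨ φ [ ys ++ ρ ])
  ∃[]-⊨ zero    φ = mk⇔ (λ x → [] , x) (λ { ([] , x) → x })
  ∃[]-⊨ (suc m) φ = mk⇔
    (λ x → let ys , y , h = to (∃[]-⊨ m (`∃ φ)) x in y ∷ ys , h)
    (λ { (y ∷ ys , h) → from (∃[]-⊨ m (`∃ φ)) (ys , y , h) })

  ∀[]-⊨ : ∀ m (φ : Formula (m + k)) {ρ} →
          (N ⊨ `∀[ m ] φ [ ρ ]) ⇔ ((ys : Vec ∣ N ∣ m) → N ⊨ φ [ ys ++ ρ ])
  ∀[]-⊨ zero    φ = mk⇔ (λ { x [] → x }) (λ h → h [])
  ∀[]-⊨ (suc m) φ = mk⇔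
    (λ { x (y ∷ ys) → to (∀[]-⊨ m (`∀ φ)) x ys y })
    (λ h → from (∀[]-⊨ m (`∀ φ)) (λ ys y → h (y ∷ ys)))

  bexists-⊨ : ∀ m {b : Fin m → Fin k} (φ : Formula (m + k)) {ρ} {us : Vec ∣ N ∣ m} →
    Picks ρ b us →
    (N ⊨ bexists m b φ [ ρ ]) ⇔ (Σ[ ys ∈ Vec ∣ N ∣ m ] ys <ᵛ us × N ⊨ φ [ ys ++ ρ ])
  bexists-⊨ zero φ {us = []} p = mk⇔ (λ x → [] , [] , x) (λ { ([] , [] , x) → x })
  bexists-⊨ (suc m) {b} φ {ρ} {u ∷ us} p = mk⇔
    (λ x → let ys , ys<us , y , y<u , h = to IH x in
      y ∷ ys , subst (Structure._<_ N y) (bound ys) y<u ∷ ys<us , h)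
    (λ { (y ∷ ys , y<u ∷ ys<us , h) →
      from IH (ys , ys<us , y , subst (Structure._<_ N y) (sym (bound ys)) y<u , h) })
    where
    IH = bexists-⊨ m (`∃ (var zero `< wk (var (m ↑ʳ b zero)) `∧ φ)) {ρ} {us}
           (picks (at p ∘ suc))
    bound : ∀ ys → lookup (ys ++ ρ) (m ↑ʳ b zero) ≡ u
    bound ys = trans (lookup-++ʳ ys ρ (b zero)) (at p zero)

-- The parameters of `Collₛ` are put among the bounded variables, so one bound serves all their
-- values below a given tuple. This uniformity later reaches parameters of `K` that lie outside `M`.
StrongColl : (M : Structure ℓ) → FormulaClass → Set ℓ
StrongColl M Γ = ∀ q {k} (φ : Formula (q + k)) → Γ φ → (us : Vec ∣ M ∣ k) →
  ∃[ vs ] ∀ xs → xs <ᵛ us →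
    (Σ[ ys ∈ Vec ∣ M ∣ q ] M ⊨ φ [ ys ++ xs ]) →
    Σ[ ys ∈ Vec ∣ M ∣ q ] ys <ᵛ vs × M ⊨ φ [ ys ++ xs ]
  where open Structure M using (_<ᵛ_)

pad : ∀ q → Fin (q + k) → Fin (q + (k + 0))
pad q = lifts q (_↑ˡ 0)

module _ {M : Structure ℓ} where

  pad-⊨ : (φ : Formula (q + k)) (ys : Vec ∣ M ∣ q) (xs : Vec ∣ M ∣ k) →
          (M ⊨ ren (pad q) φ [ ys ++ xs ++ [] ]) ⇔ (M ⊨ φ [ ys ++ xs ])
  pad-⊨ φ ys xs = ren-⊨ M φ (picks-lifts ys (picks-ˡ xs []))

  Collₛ⇒StrongColl : Collₛ M (Σₙ n) → StrongColl M (Σₙ n)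
  Collₛ⇒StrongColl coll q {k} φ σ us =
    let vs , h = coll k q 0 (ren (pad q) φ) (ren-Σₙ (pad q) σ) [] us
    in vs , λ xs xs<us (ys , y) →
      let ys′ , ys′<vs , y′ = h xs xs<us (ys , from (pad-⊨ φ ys xs) y)
      in ys′ , ys′<vs , to (pad-⊨ φ ys′ xs) y′

-- `PA⁻` is given by its sentences, so transitivity is written as one and checked in the rings. The
-- arguments come in reverse order because the outermost quantifier binds the highest index.
<-trans : {N : Structure ℓ} → N ⊨ᵀ PA⁻ ℓ → Transitive (Structure._<_ N)
<-trans N⊨PA⁻ {x} {y} {z} = N⊨PA⁻
  (`∀ `∀ `∀ (var zero `< var (suc zero) `⇒ var (suc zero) `< var (suc (suc zero)) `⇒
             var zero `< var (suc (suc zero))))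
  (λ R _ _ _ → DiscretelyOrderedRing.<-trans R) z y x

-- Negations and disjunctions in the hierarchy

module Classical (em : ExcludedMiddle ℓ) where

  infix 4 _≈_
  -- All structures are quantified over so that one normal form can be used in both `M` and `K`.
  _≈_ : Formula k → Formula k → Set _
  φ ≈ ψ = (N : Structure ℓ) → ∀ ρ → (N ⊨ φ [ ρ ]) ⇔ (N ⊨ ψ [ ρ ])

  dne : {P : Set ℓ} → ((P → ⊥ {ℓ}) → ⊥ {ℓ}) → P
  dne {P} ¬¬p with em {P}
  ... | yes p = p
  ... | no ¬p = ⊥-elim (¬¬p (λ p → contradiction p ¬p))

  mutual
    -- A negated formula is in general not syntactically in the dual class, so the negation is
    -- pushed through the blocks to the Δ₀ matrix.
    ¬-Σₙ : {φ : Formula k} → Σₙ n φ → Σ[ χ ∈ Formula k ] Πₙ n χ × χ ≈ `¬ φ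
    ¬-Σₙ (base d) = _ , base (imp d bot) , λ N ρ → ⇔-id _
    ¬-Σₙ (block m {φ} π) =
      let χ , σ , χ≈¬φ = ¬-Πₙ π in
      `∀[ m ] χ , block m σ , λ N ρ → mk⇔
        (λ h x → let ys , y = to (∃[]-⊨ N m φ) x
                 in to (χ≈¬φ N _) (to (∀[]-⊨ N m χ) h ys) y)
        (λ h → from (∀[]-⊨ N m χ) λ ys →
          from (χ≈¬φ N _) λ y → h (from (∃[]-⊨ N m φ) (ys , y)))

    ¬-Πₙ : {φ : Formula k} → Πₙ n φ → Σ[ χ ∈ Formula k ] Σₙ n χ × χ ≈ `¬ φ
    ¬-Πₙ (base d) = _ , base (imp d bot) , λ N ρ → ⇔-id _
    ¬-Πₙ (block m {φ} σ) =
      let χ , π , χ≈¬φ = ¬-Σₙ σ in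
      `∃[ m ] χ , block m π , λ N ρ → mk⇔
        (λ x h → let ys , y = to (∃[]-⊨ N m χ) x
                 in to (χ≈¬φ N _) y (to (∀[]-⊨ N m φ) h ys))
        (λ h → dne λ ¬∃ → h (from (∀[]-⊨ N m φ) λ ys →
          dne λ ¬y → ¬∃ (from (∃[]-⊨ N m χ) (ys , from (χ≈¬φ N _) ¬y))))

  private
    embˡ : ∀ m m′ → Fin (m + k) → Fin ((m + m′) + k)
    embˡ {k} m m′ = join ((_↑ˡ k) ∘ (_↑ˡ m′)) ((m + m′) ↑ʳ_)

    embʳ : ∀ m m′ → Fin (m′ + k) → Fin ((m + m′) + k)
    embʳ {k} m m′ = join ((_↑ˡ k) ∘ (m ↑ʳ_)) ((m + m′) ↑ʳ_)

    module _ (N : Structure ℓ) {m m′ k} (ys : Vec ∣ N ∣ m)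
             (zs : Vec ∣ N ∣ m′) (ρ : Vec ∣ N ∣ k) where

      embˡ-⊨ : ∀ φ → (N ⊨ ren (embˡ m m′) φ [ (ys ++ zs) ++ ρ ]) ⇔ (N ⊨ φ [ ys ++ ρ ])
      embˡ-⊨ φ = ren-⊨ N φ (picks-join
        (picks-∘ (picks-ˡ (ys ++ zs) ρ) (picks-ˡ ys zs)) (picks-ʳ (ys ++ zs) ρ))

      embʳ-⊨ : ∀ φ → (N ⊨ ren (embʳ m m′) φ [ (ys ++ zs) ++ ρ ]) ⇔ (N ⊨ φ [ zs ++ ρ ])
      embʳ-⊨ φ = ren-⊨ N φ (picks-join
        (picks-∘ (picks-ˡ (ys ++ zs) ρ) (picks-ʳ ys zs)) (picks-ʳ (ys ++ zs) ρ))

  mutual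
    -- The two leading blocks merge into one of length `m + m′`, where `embˡ` and `embʳ` let each
    -- matrix see only its own half.
    ∨-Σₙ : ∀ n {φ ψ : Formula k} → Σₙ n φ → Σₙ n ψ →
           Σ[ χ ∈ Formula k ] Σₙ n χ × χ ≈ (φ `∨ ψ)
    ∨-Σₙ zero (base d) (base e) = _ , base (or d e) , λ N ρ → ⇔-id _
    ∨-Σₙ (suc n) (block m {φ} π) (block m′ {ψ} π′) =
      let χ , σ , χ≈ = ∨-Πₙ n (ren-Πₙ (embˡ m m′) π) (ren-Πₙ (embʳ m m′) π′) in
      `∃[ m + m′ ] χ , block (m + m′) σ , λ N ρ → mk⇔
        (λ x → split N ρ (λ ys → to (χ≈ N (ys ++ ρ))) (to (∃[]-⊨ N (m + m′) χ) x))
        λ { (inj₁ x) → let ys , y = to (∃[]-⊨ N m φ) x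
                           -- The half of the witness that `φ` does not read is filled with an
                           -- arbitrary element.
                           zs = replicate m′ (Structure.0# N)
                       in from (∃[]-⊨ N (m + m′) χ)
                            (ys ++ zs , from (χ≈ N _) (inj₁ (from (embˡ-⊨ N ys zs ρ φ) y)))
          ; (inj₂ x) → let zs , z = to (∃[]-⊨ N m′ ψ) x
                           ys = replicate m (Structure.0# N)
                       in from (∃[]-⊨ N (m + m′) χ)
                            (ys ++ zs , from (χ≈ N _) (inj₂ (from (embʳ-⊨ N ys zs ρ ψ) z))) }
      where
      split : ∀ N ρ {P : Vec ∣ N ∣ (m + m′) → Set ℓ} →
        (∀ ys → P ys → (N ⊨ ren (embˡ m m′) φ [ ys ++ ρ ]) ⊎ (N ⊨ ren (embʳ m m′) ψ [ ys ++ ρ ])) →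
        Σ _ P → (N ⊨ `∃[ m ] φ [ ρ ]) ⊎ (N ⊨ `∃[ m′ ] ψ [ ρ ])
      split N ρ h (ws , x) with Vec.splitAt m ws
      ... | ys , zs , refl with h (ys ++ zs) x
      ... | inj₁ y = inj₁ (from (∃[]-⊨ N m φ) (ys , to (embˡ-⊨ N ys zs ρ φ) y))
      ... | inj₂ z = inj₂ (from (∃[]-⊨ N m′ ψ) (zs , to (embʳ-⊨ N ys zs ρ ψ) z))

    ∨-Πₙ : ∀ n {φ ψ : Formula k} → Πₙ n φ → Πₙ n ψ →
           Σ[ χ ∈ Formula k ] Πₙ n χ × χ ≈ (φ `∨ ψ)
    ∨-Πₙ zero (base d) (base e) = _ , base (or d e) , λ N ρ → ⇔-id _
    ∨-Πₙ (suc n) (block m {φ} σ) (block m′ {ψ} σ′) =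
      let χ , π , χ≈ = ∨-Σₙ n (ren-Σₙ (embˡ m m′) σ) (ren-Σₙ (embʳ m m′) σ′) in
      `∀[ m + m′ ] χ , block (m + m′) π , λ N ρ → mk⇔
        -- Separating the universal blocks is classical: a counterexample `ys` to the left disjunct
        -- forces the right one at `ys ++ zs` for every `zs`.
        (λ x → dne λ ¬∨ → ¬∨ (inj₁ (from (∀[]-⊨ N m φ) λ ys → dne λ ¬y →
          ¬∨ (inj₂ (from (∀[]-⊨ N m′ ψ) λ zs →
            case to (χ≈ N _) (to (∀[]-⊨ N (m + m′) χ) x (ys ++ zs)) of λ
              { (inj₁ y) → ⊥-elim (¬y (to (embˡ-⊨ N ys zs ρ φ) y))
              ; (inj₂ z) → to (embʳ-⊨ N ys zs ρ ψ) z })))))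
        λ x → from (∀[]-⊨ N (m + m′) χ) λ ws → from (χ≈ N _) (split N ρ ws x)
      where
      split : ∀ N ρ ws → (N ⊨ `∀[ m ] φ [ ρ ]) ⊎ (N ⊨ `∀[ m′ ] ψ [ ρ ]) →
        (N ⊨ ren (embˡ m m′) φ [ ws ++ ρ ]) ⊎ (N ⊨ ren (embʳ m m′) ψ [ ws ++ ρ ])
      split N ρ ws x with Vec.splitAt m ws
      split N ρ ws (inj₁ x) | ys , zs , refl =
        inj₁ (from (embˡ-⊨ N ys zs ρ φ) (to (∀[]-⊨ N m φ) x ys))
      split N ρ ws (inj₂ x) | ys , zs , refl =
        inj₂ (from (embʳ-⊨ N ys zs ρ ψ) (to (∀[]-⊨ N m′ ψ) x zs))

  -- Collection is applied to ∃y′ φ(x,y′) → φ(x,y), which holds for some y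
  -- whatever x is.
  Coll⇒StrongColl : {M : Structure ℓ} → Coll M (Σₙ (suc n)) → m < n → StrongColl M (Πₙ m)
  Coll⇒StrongColl {n = n} {m} {M} coll m<n q {k} φ π us =
    -- `δ` says that `φ` has no witness, and `χ` is equivalent to the disjunction of `δ` and `φ`. It
    -- is Π at level `m + 1`, which is at most `n`, so an empty block puts it in the class that
    -- `coll` covers.
    let δ , δΠ , δ≈ = ¬-Σₙ (block q π)
        χ , χΠ , χ≈ = ∨-Πₙ (suc m) (ren-Πₙ (q ↑ʳ_) δΠ) (Πₙ-mono (m≤n⇒m≤1+n ≤-refl) π)
        vs , h = coll k q 0 (ren (pad q) χ) (block 0 (ren-Πₙ (pad q) (Πₙ-mono m<n χΠ))) [] us
          λ xs _ → case em {Σ[ ys ∈ Vec ∣ M ∣ q ] M ⊨ φ [ ys ++ xs ]} of λ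
            { (yes (ys , y)) → ys , from (pad-⊨ χ ys xs) (from (χ≈ M _) (inj₂ y))
            ; (no ¬∃) → let ys = replicate q (Structure.0# M) in
                ys , from (pad-⊨ χ ys xs) (from (χ≈ M _) (inj₁
                  (from (ren-⊨ M δ (picks-ʳ ys xs)) (from (δ≈ M xs)
                    λ x → contradiction (to (∃[]-⊨ M q φ) x) ¬∃)))) }
    in vs , λ xs xs<us ∃y →
      let ys , ys<vs , c = h xs xs<us
      in ys , ys<vs , (case to (χ≈ M _) (to (pad-⊨ χ ys xs) c) of λ
        { (inj₁ d) → ⊥-elim (to (δ≈ M xs) (to (ren-⊨ M δ (picks-ʳ ys xs)) d)
                               (from (∃[]-⊨ M q φ) ∃y))
        ; (inj₂ y) → y })

-- Tame formulas

module CofinalExtension (em : ExcludedMiddle ℓ) {M K : Structure ℓ}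
  (M⊆K : Substructure M K) (cofinal : Cofinal M⊆K) (Δ₀-elem : Elementary M⊆K Δ₀) where

  open Classical em
  open Substructure M⊆K
  private
    module M = Structure M
    module K = Structure K

  -- Indexing M and K by Bool lets facts about both be proved once.
  side : Bool → Structure ℓ
  side true  = M
  side false = K

  embed : ∀ b → Vec ∣ M ∣ k → Vec ∣ side b ∣ k
  embed true  = id
  embed false = map ι

  embed-++ : ∀ b (xs : Vec ∣ M ∣ k) (ys : Vec ∣ M ∣ l) →
             embed b (xs ++ ys) ≡ embed b xs ++ embed b ys
  embed-++ true  xs ys = refl
  embed-++ false xs ys = map-++ ι xs ys

  picks-embed : ∀ b {ρ : Vec ∣ M ∣ l} {f : Fin k → Fin l} {xs} →
                Picks ρ f xs → Picks (embed b ρ) f (embed b xs)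
  picks-embed true  p = p
  picks-embed false {ρ} {f} {xs} (picks p) = picks λ i →
    trans (lookup-map (f i) ι ρ) (trans (cong ι (p i)) (sym (lookup-map i ι xs)))

  Below : ∀ b → Vec ∣ side b ∣ k → Vec ∣ M ∣ k → Set ℓ
  Below b xs us = Structure._<ᵛ_ (side b) xs (embed b us)

  below-++ : ∀ b {xs : Vec ∣ side b ∣ k} {ys : Vec ∣ side b ∣ l} {us vs} →
             Below b xs us → Below b ys vs → Below b (xs ++ ys) (us ++ vs)
  below-++ b {us = us} {vs} p q rewrite embed-++ b us vs = ++⁺ p q

  <-reflects : ∀ {a b} → ι a K.< ι b → a M.< b
  <-reflects {a} {b} = from (<-iff a b)

  below-mono : {xs us : Vec ∣ M ∣ k} → Below true xs us → Below false (map ι xs) us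
  below-mono []       = []
  below-mono (p ∷ ps) = to (<-iff _ _) p ∷ below-mono ps

  boundK : (xs : Vec ∣ K ∣ k) → ∃[ us ] Below false xs us
  boundK []       = [] , []
  boundK (x ∷ xs) =
    let u , x<u = cofinal x ; us , xs<us = boundK xs in u ∷ us , x<u ∷ xs<us

  boundM : (xs : Vec ∣ M ∣ k) → ∃[ us ] Below true xs us
  boundM []       = [] , []
  boundM (x ∷ xs) =
    let u , x<u = cofinal (ι x) ; us , xs<us = boundM xs
    in u ∷ us , <-reflects x<u ∷ xs<us

  -- Δ₀ formulas with parameters from `M`

  record ParamΔ₀ k : Set ℓ where
    no-eta-equality
    field
      {p}     : ℕ
      formula : Formula (k + p)
      isΔ₀    : Δ₀ formula
      params  : Vec ∣ M ∣ p

  -- A record rather than a synonym, so that `D`, `b` and `xs` stay visible to unification.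
  record Holds (D : ParamΔ₀ k) b (xs : Vec ∣ side b ∣ k) : Set ℓ where
    constructor holds
    open ParamΔ₀ D
    field holds⁻ : side b ⊨ formula [ xs ++ embed b params ]
  open Holds

  Holds-⇔ : ∀ D b {xs : Vec ∣ side b ∣ k} → let open ParamΔ₀ D in
            Holds D b xs ⇔ (side b ⊨ formula [ xs ++ embed b params ])
  Holds-⇔ D b = mk⇔ holds⁻ holds

  -- Elementarity for Δ₀ enters here: the parameters lie in `M`, so they count as further arguments
  -- beside `xs`.
  Holds-elem : (D : ParamΔ₀ k) → ∀ xs → Holds D true xs ⇔ Holds D false (map ι xs)
  Holds-elem D xs = ⇔-sym (Holds-⇔ D false) ⇔-∘ (subst (λ ρ → _ ⇔ (K ⊨ formula [ ρ ]))
    (map-++ ι xs params) (Δ₀-elem formula isΔ₀ (xs ++ params)) ⇔-∘ Holds-⇔ D true)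
    where open ParamΔ₀ D

  plain : (φ : Formula k) → Δ₀ φ → ParamΔ₀ k
  plain φ d = record { formula = ren (_↑ˡ 0) φ ; isΔ₀ = ren-Δ₀ _ d ; params = [] }

  Holds-plain : ∀ (φ : Formula k) d b {xs} → Holds (plain φ d) b xs ⇔ (side b ⊨ φ [ xs ])
  Holds-plain φ d b {xs} = ren-⊨ (side b) φ (picks-ˡ xs _) ⇔-∘ Holds-⇔ (plain φ d) b

  ¬ᴾ_ : ParamΔ₀ k → ParamΔ₀ k
  ¬ᴾ D = record { formula = `¬ formula ; isΔ₀ = imp isΔ₀ bot ; params = params }
    where open ParamΔ₀ D

  Holds-¬ : (D : ParamΔ₀ k) → ∀ b {xs} → Holds (¬ᴾ D) b xs ⇔ (Holds D b xs → ⊥ {ℓ})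
  Holds-¬ D b = mk⇔ (λ h d → holds⁻ h (holds⁻ d)) (λ ¬d → holds (¬d ∘ holds))

  reindex : (Fin k → Fin l) → ParamΔ₀ k → ParamΔ₀ l
  reindex {l = l} f D = record
    { formula = ren (join ((_↑ˡ p) ∘ f) (l ↑ʳ_)) formula
    ; isΔ₀    = ren-Δ₀ _ isΔ₀
    ; params  = params
    }
    where open ParamΔ₀ D

  Holds-reindex : ∀ {f : Fin k → Fin l} D b {ρ xs} → Picks ρ f xs →
                  Holds (reindex f D) b ρ ⇔ Holds D b xs
  Holds-reindex {f = f} D b {ρ} pf =
    ⇔-sym (Holds-⇔ D b) ⇔-∘ (ren-⊨ (side b) (ParamΔ₀.formula D)
      (picks-join (picks-∘ (picks-ˡ ρ _) pf) (picks-ʳ ρ _))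
    ⇔-∘ Holds-⇔ (reindex f D) b)

  _∧ᴾ_ : ParamΔ₀ k → ParamΔ₀ k → ParamΔ₀ k
  _∧ᴾ_ {k} D E = record
    { formula = ren (join (_↑ˡ (D.p + E.p)) ((k ↑ʳ_) ∘ (_↑ˡ E.p))) D.formula
             `∧ ren (join (_↑ˡ (D.p + E.p)) ((k ↑ʳ_) ∘ (D.p ↑ʳ_))) E.formula
    ; isΔ₀    = and (ren-Δ₀ _ D.isΔ₀) (ren-Δ₀ _ E.isΔ₀)
    ; params  = D.params ++ E.params
    }
    where
    module D = ParamΔ₀ D
    module E = ParamΔ₀ E

  Holds-∧ : (D E : ParamΔ₀ k) → ∀ b {xs} →
            Holds (D ∧ᴾ E) b xs ⇔ (Holds D b xs × Holds E b xs)
  Holds-∧ D E b {xs} = mk⇔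
    (λ h → holds (to renD (proj₁ (holds⁻ h))) , holds (to renE (proj₂ (holds⁻ h))))
    (λ (d , e) → holds (from renD (holds⁻ d) , from renE (holds⁻ e)))
    where
    module D = ParamΔ₀ D
    module E = ParamΔ₀ E
    renD = ren-⊨ (side b) D.formula (picks-join (picks-ˡ xs _)
      (picks-∘ (picks-ʳ xs _) (picks-embed b (picks-ˡ D.params E.params))))
    renE = ren-⊨ (side b) E.formula (picks-join (picks-ˡ xs _)
      (picks-∘ (picks-ʳ xs _) (picks-embed b (picks-ʳ D.params E.params))))

  -- `bexists` takes its bounds from variables, so `vs` is prepended to the parameters; the inner
  -- renaming makes room for it between the free variables and the old parameters.
  ∃< : Vec ∣ M ∣ q → ParamΔ₀ (q + k) → ParamΔ₀ k
  ∃< {q} {k} vs D = record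
    { formula = bexists q ((k ↑ʳ_) ∘ (_↑ˡ p))
        (ren (join (join {m = q} (_↑ˡ (k + (q + p))) ((q ↑ʳ_) ∘ (_↑ˡ (q + p))))
                   ((q ↑ʳ_) ∘ (k ↑ʳ_) ∘ (q ↑ʳ_)))
             formula)
    ; isΔ₀    = bexists-Δ₀ q _ (ren-Δ₀ _ isΔ₀)
    ; params  = vs ++ params
    }
    where open ParamΔ₀ D

  Holds-∃< : (vs : Vec ∣ M ∣ q) (D : ParamΔ₀ (q + k)) → ∀ b {xs} →
    Holds (∃< vs D) b xs ⇔ (Σ[ ys ∈ Vec ∣ side b ∣ q ] Below b ys vs × Holds D b (ys ++ xs))
  Holds-∃< {q} vs D b {xs} = mk⇔
    (λ h → let ys , ys<vs , y = to bex (holds⁻ h) in ys , ys<vs , holds (to (renamed ys) y))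
    (λ (ys , ys<vs , y) → holds (from bex (ys , ys<vs , from (renamed ys) (holds⁻ y))))
    where
    open ParamΔ₀ D
    bex = bexists-⊨ (side b) q _
      (picks-∘ (picks-ʳ xs _) (picks-embed b (picks-ˡ vs params)))
    renamed = λ ys → ren-⊨ (side b) formula
      (picks-join
        (picks-join (picks-ˡ ys _) (picks-∘ (picks-ʳ ys _) (picks-ˡ xs _)))
        (picks-∘ (picks-ʳ ys _)
          (picks-∘ (picks-ʳ xs _) (picks-embed b (picks-ʳ vs params)))))

  -- Bounding every free variable leaves a closed Δ₀ statement about elements of `M`, to which
  -- `Holds-elem` applies.
  reflect-∃< : (D : ParamΔ₀ k) → ∀ us →
    (Σ[ xs ∈ Vec ∣ K ∣ k ] Below false xs us × Holds D false xs) →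
    Σ[ xs ∈ Vec ∣ M ∣ k ] Below true xs us × Holds D true xs
  reflect-∃< {k} D us (xs , xs<us , x) =
    let xs′ , xs′<us , x′ = to (Holds-∃< us D′ true)
          (from (Holds-elem (∃< us D′) [])
            (from (Holds-∃< us D′ false)
              (xs , xs<us , from (Holds-reindex D false (picks-ˡ xs [])) x)))
    in xs′ , xs′<us , to (Holds-reindex D true (picks-ˡ xs′ [])) x′
    where D′ = reindex (_↑ˡ 0) D

  -- Tameness through the hierarchy and the transfer of bounds

  Agree : Formula k → Vec ∣ M ∣ k → ParamΔ₀ k → Set ℓ
  Agree φ us D = ∀ b xs → Below b xs us → (side b ⊨ φ [ xs ]) ⇔ Holds D b xs

  Tame : Formula k → Set ℓ
  Tame {k} φ = (us : Vec ∣ M ∣ k) → ∃[ D ] Agree φ us D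

  Bounding : ∀ b → Formula (q + k) → Vec ∣ M ∣ q → Vec ∣ M ∣ k → Set ℓ
  Bounding {q} {k} b φ vs us = (xs : Vec ∣ side b ∣ k) → Below b xs us →
    (Σ[ ys ∈ Vec ∣ side b ∣ q ] side b ⊨ φ [ ys ++ xs ]) →
    Σ[ ys ∈ Vec ∣ side b ∣ q ] Below b ys vs × side b ⊨ φ [ ys ++ xs ]

  -- The witness `ys` of a failure in `K` lies below some `ws` from `M`. With `D` and `E` standing
  -- for `φ` on the ranges below `ws` and `vs`, the failure reads `G`: `D` holds, yet no tuple below
  -- `vs` satisfies `E`. By reflection `G` would be satisfied in `M` below `ws` and `us`, against
  -- `bounding`.
  tame-bounding : (φ : Formula (q + k)) → Tame φ → ∀ {vs us} →
                  Bounding true φ vs us → Bounding false φ vs us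
  tame-bounding {q} φ tame {vs} {us} bounding xs xs<us (ys , y)
    with ws , ys<ws ← boundK ys
    with D , D≈φ ← tame (ws ++ us)
    with E , E≈φ ← tame (vs ++ us)
    = dne λ ¬∃ → noneM (reflect-∃< (∃< ws G) us (xs , xs<us ,
        from (Holds-∃< ws G false) (ys , ys<ws ,
          from (Holds-∧ D (¬ᴾ reindex (q ↑ʳ_) F) false)
            ( to (D≈φ false (ys ++ xs) (below-++ false ys<ws xs<us)) y
            , from (Holds-¬ (reindex (q ↑ʳ_) F) false)
                (λ f → ¬∃ (F⇒∃ (to (Holds-reindex F false (picks-ʳ ys xs)) f)))))))
    where
    F : ParamΔ₀ _
    F = ∃< vs E

    G : ParamΔ₀ _
    G = D ∧ᴾ (¬ᴾ reindex (q ↑ʳ_) F)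

    F⇒∃ : Holds F false xs → _
    F⇒∃ f with ys₀ , ys₀<vs , y₀ ← to (Holds-∃< vs E false) f =
      ys₀ , ys₀<vs , from (E≈φ false (ys₀ ++ xs) (below-++ false ys₀<vs xs<us)) y₀

    noneM : (Σ[ xs ∈ Vec ∣ M ∣ _ ] Below true xs us × Holds (∃< ws G) true xs) → ⊥ {ℓ}
    noneM (xs , xs<us , x)
      with ys , ys<ws , y ← to (Holds-∃< ws G true) x
      with d , ¬f ← to (Holds-∧ D (¬ᴾ reindex (q ↑ʳ_) F) true) y
      with ys₁ , ys₁<vs , y₁ ← bounding xs xs<us
        (ys , from (D≈φ true (ys ++ xs) (below-++ true ys<ws xs<us)) d)
      = to (Holds-¬ (reindex (q ↑ʳ_) F) true) ¬f (from (Holds-reindex F true (picks-ʳ ys xs))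
          (from (Holds-∃< vs E true) (ys₁ , ys₁<vs ,
            to (E≈φ true (ys₁ ++ xs) (below-++ true ys₁<vs xs<us)) y₁)))

  tame-¬ : (φ χ : Formula k) → χ ≈ `¬ φ → Tame χ → Tame φ
  tame-¬ φ χ χ≈¬φ tame us =
    let D , D≈χ = tame us in
    ¬ᴾ D , λ b xs xs<us → mk⇔
      (λ x → from (Holds-¬ D b) λ d → to (χ≈¬φ (side b) xs) (from (D≈χ b xs xs<us) d) x)
      (λ ¬d → dne λ ¬x → to (Holds-¬ D b) ¬d (to (D≈χ b xs xs<us) (from (χ≈¬φ (side b) xs) ¬x)))

  tame-Δ₀ : {φ : Formula k} → Δ₀ φ → Tame φ
  tame-Δ₀ {φ = φ} d us = plain φ d , λ b xs _ → ⇔-sym (Holds-plain φ d b)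

  mutual
    -- Strong collection for the matrix yields `vs` in `M` bounding the witnesses, and
    -- `tame-bounding` makes the same `vs` work in `K`. The block then becomes `∃< vs`, with the
    -- tame matrix replaced by its `D`.
    tame-Σₙ : ∀ n → (∀ {m} → m < n → StrongColl M (Πₙ m)) →
              {φ : Formula k} → Σₙ n φ → Tame φ
    tame-Σₙ zero    coll (base d) = tame-Δ₀ d
    tame-Σₙ (suc n) coll (block q {φ} π) us =
      let tame    = tame-Πₙ n (λ m<n → coll (m≤n⇒m≤1+n m<n)) π
          vs , hM = coll ≤-refl q φ π us
          D , D≈φ = tame (vs ++ us)
          bounding : ∀ b → Bounding b φ vs us
          bounding = λ { true → hM ; false → tame-bounding φ tame hM }
      in ∃< vs D , λ b xs xs<us → mk⇔
        (λ x → let ys , ys<vs , y = bounding b xs xs<us (to (∃[]-⊨ (side b) q φ) x)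
               in from (Holds-∃< vs D b)
                    (ys , ys<vs , to (D≈φ b (ys ++ xs) (below-++ b ys<vs xs<us)) y))
        (λ h → let ys , ys<vs , d = to (Holds-∃< vs D b) h
               in from (∃[]-⊨ (side b) q φ)
                    (ys , from (D≈φ b (ys ++ xs) (below-++ b ys<vs xs<us)) d))

    tame-Πₙ : ∀ n → (∀ {m} → m < n → StrongColl M (Πₙ m)) →
              {φ : Formula k} → Πₙ n φ → Tame φ
    tame-Πₙ zero    coll (base d) = tame-Δ₀ d
    tame-Πₙ (suc n) coll (block m {φ} σ) =
      let χ , χΣ , χ≈¬φ = ¬-Πₙ (block m σ) in
      -- The level is unchanged in this call; it drops when `tame-Σₙ` turns to its matrix.
      tame-¬ (`∀[ m ] φ) χ χ≈¬φ (tame-Σₙ (suc n) coll χΣ)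

  -- Below a bound above `ρ`, satisfaction in either structure agrees with the same `D`, which is
  -- absolute.
  tame-elem : (φ : Formula k) → Tame φ → ∀ ρ → (M ⊨ φ [ ρ ]) ⇔ (K ⊨ φ [ map ι ρ ])
  tame-elem φ tame ρ =
    let us , ρ<us = boundM ρ
        D , D≈φ   = tame us
    in ⇔-sym (D≈φ false (map ι ρ) (below-mono ρ<us)) ⇔-∘
         (Holds-elem D ρ ⇔-∘ D≈φ true ρ ρ<us)

  -- Elementarity at levels `n + 1` and `n + 2`

  Πₙ-elem : Elementary M⊆K (Σₙ n) → Elementary M⊆K (Πₙ n)
  Πₙ-elem elem φ π ρ =
    let χ , σ , χ≈¬φ = ¬-Πₙ π in mk⇔
      (λ x → dne λ ¬x →
        to (χ≈¬φ M ρ) (from (elem χ σ ρ) (from (χ≈¬φ K (map ι ρ)) ¬x)) x)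
      (λ x → dne λ ¬x →
        to (χ≈¬φ K (map ι ρ)) (to (elem χ σ ρ) (from (χ≈¬φ M ρ) ¬x)) x)

  ∃-upward : ∀ q (φ : Formula (q + k)) →
             (∀ ρ → (M ⊨ φ [ ρ ]) ⇔ (K ⊨ φ [ map ι ρ ])) →
             ∀ ρ → M ⊨ `∃[ q ] φ [ ρ ] → K ⊨ `∃[ q ] φ [ map ι ρ ]
  ∃-upward q φ elem ρ x =
    let ys , y = to (∃[]-⊨ M q φ) x
    in from (∃[]-⊨ K q φ) (map ι ys ,
         subst (λ σ → K ⊨ φ [ σ ]) (map-++ ι ys ρ) (to (elem (ys ++ ρ)) y))

  -- For the descent, cofinality puts a witness from `K` below some `ws` from `M`; with `D` in place
  -- of the tame matrix, the existence of a witness below `ws` is Δ₀ and holds in `M`.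
  Σ₁₊ₙ-elem : (∀ {k} {φ : Formula k} → Πₙ n φ → Tame φ) → Elementary M⊆K (Σₙ (suc n))
  Σ₁₊ₙ-elem tame _ (block q {φ} π) ρ =
    mk⇔ (∃-upward q φ (tame-elem φ (tame π)) ρ) (down ∘ to (∃[]-⊨ K q φ))
    where
    down : (Σ[ ys ∈ Vec ∣ K ∣ q ] K ⊨ φ [ ys ++ map ι ρ ]) → M ⊨ `∃[ q ] φ [ ρ ]
    down (ys , y)
      with ws , ys<ws ← boundK ys
      with us , ρ<us ← boundM ρ
      with D , D≈φ ← tame π (ws ++ us)
      with zs , zs<ws , z ← to (Holds-∃< ws D true) (from (Holds-elem (∃< ws D) ρ)
        (from (Holds-∃< ws D false) (ys , ys<ws ,
          to (D≈φ false (ys ++ map ι ρ) (below-++ false ys<ws (below-mono ρ<us))) y)))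
      = from (∃[]-⊨ M q φ)
          (zs , from (D≈φ true (zs ++ ρ) (below-++ true zs<ws ρ<us)) z)

  -- The matrix `φ` is one level above the formulas assumed tame. Upwards, it is preserved by the
  -- previous level; downwards, tameness is applied to `ψ`, the matrix of the negation of `φ`.
  Σ₂₊ₙ-elem : Coll M (Σₙ (suc n)) → (∀ {k} {φ : Formula k} → Πₙ n φ → Tame φ) →
              Elementary M⊆K (Σₙ (suc (suc n)))
  Σ₂₊ₙ-elem {n} coll tame _ (block q {φ} π) ρ =
    mk⇔ (∃-upward q φ (Πₙ-elem (Σ₁₊ₙ-elem tame) φ π) ρ)
        (λ x → dne λ ¬x → down ¬x (¬-Πₙ π) (to (∃[]-⊨ K q φ) x))
    where
    down : (M ⊨ `∃[ q ] φ [ ρ ] → ⊥ {ℓ}) →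
      (Σ[ χ ∈ Formula _ ] Σₙ (suc n) χ × χ ≈ `¬ φ) →
      (Σ[ ys ∈ Vec ∣ K ∣ q ] K ⊨ φ [ ys ++ map ι ρ ]) → ⊥ {ℓ}
    down ¬x (_ , block r {ψ} πψ , χ≈¬φ) (ys , y)
      with bs , ys<bs ← boundK ys
      with us , ρ<us ← boundM ρ
      -- In `M` every `zs` fails `φ` and so has a witness for `ψ`; collection over `zs` below `bs`
      -- gathers these below `cs`.
      with cs , collected ← coll q r _ ψ (block 0 πψ) ρ bs (λ zs _ →
        to (∃[]-⊨ M r ψ) (from (χ≈¬φ M (zs ++ ρ)) (λ z → ¬x (from (∃[]-⊨ M q φ) (zs , z)))))
      with D , D≈ψ ← tame πψ (cs ++ (bs ++ us))
      -- The transfer runs contrapositively: `ys` lies below `bs` and has no witness for `ψ` below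
      -- `cs`, so such a tuple also exists in `M`, against `collected`.
      = noneM (to (Holds-∃< bs E true) (from (Holds-elem (∃< bs E) ρ)
          (from (Holds-∃< bs E false) (ys , ys<bs , from (Holds-¬ F false) λ f →
            noneK (to (Holds-∃< cs D false) f)))))
      where
      F : ParamΔ₀ _
      F = ∃< cs D

      E : ParamΔ₀ _
      E = ¬ᴾ F

      noneK : (Σ[ zs ∈ Vec ∣ K ∣ r ] Below false zs cs ×
                 Holds D false (zs ++ (ys ++ map ι ρ))) → ⊥ {ℓ}
      noneK (zs , zs<cs , z) = to (χ≈¬φ K (ys ++ map ι ρ))
        (from (∃[]-⊨ K r ψ) (zs , from
          (D≈ψ false (zs ++ (ys ++ map ι ρ))
            (below-++ false zs<cs (below-++ false ys<bs (below-mono ρ<us)))) z)) y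

      noneM : (Σ[ ys ∈ Vec ∣ M ∣ q ] Below true ys bs × Holds E true (ys ++ ρ)) → ⊥ {ℓ}
      noneM (ys , ys<bs , e) with zs , zs<cs , z ← collected ys ys<bs =
        to (Holds-¬ F true) e (from (Holds-∃< cs D true) (zs , zs<cs ,
          to (D≈ψ true (zs ++ (ys ++ ρ))
            (below-++ true zs<cs (below-++ true ys<bs ρ<us))) z))

  -- Strong collection in `K`

  Collₛ-transfer : K ⊨ᵀ PA⁻ ℓ → Collₛ M (Σₙ (suc n)) → Collₛ K (Σₙ (suc n))
  Collₛ-transfer {n} K⊨PA⁻ collₛ p q r φ σ zs us =
    let us′ , us<us′ = boundK us
        zs′ , zs<zs′ = boundK zs
        -- The parameters `zs` need not lie in `M`, so they are treated as variables below `zs′`;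
        -- the resulting `vs` serves all of them at once.
        vs , hM      = strong q φ σ (us′ ++ zs′)
        hK           = tame-bounding φ tame hM
    in map ι vs , λ xs xs<us →
      hK (xs ++ zs) (below-++ false (pointwise-trans (<-trans K⊨PA⁻) xs<us us<us′) zs<zs′)
    where
    strong : StrongColl M (Σₙ (suc n))
    strong = Collₛ⇒StrongColl collₛ
    tame : Tame φ
    tame = tame-Σₙ (suc n)
      -- Here `m` is at most `n`, so `φ` is also Π at level `n`, and an empty block makes it Σ at
      -- level `n + 1`.
      (λ m<1+n q φ π → strong q φ (block 0 (Πₙ-mono (s≤s⁻¹ m<1+n) π))) σ

theorem3p4 : ∀ {ℓ} → ExcludedMiddle ℓ →
    (n : ℕ) (M K : Structure ℓ) → M ⊨ᵀ PA⁻ ℓ → K ⊨ᵀ PA⁻ ℓ →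
    (M⊆K : Substructure M K) → Cofinal M⊆K → Elementary M⊆K Δ₀ →
    (Coll M (Σₙ (suc n)) → Elementary M⊆K (Σₙ (suc (suc n))))
    × (Collₛ M (Σₙ (suc n)) → Collₛ K (Σₙ (suc n)))
theorem3p4 em n M K _ K⊨PA⁻ M⊆K cofinal Δ₀-elem =
    (λ coll → Σ₂₊ₙ-elem coll (tame-Πₙ n (Coll⇒StrongColl coll)))
  , Collₛ-transfer K⊨PA⁻
  where
  open Classical em
  open CofinalExtension em M⊆K cofinal Δ₀-elem
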